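{- Let $\mathcal{P}$ be a reliable graph property and let $G$ be a graph. Then $G$ has an induced subgraph $G'$ such that $\chi_{\rm DP}(G':\mathcal{P})=\chi_{\rm DP}(G:\mathcal{P})$ and $G'$ is $(\mathcal{P},\chi_{\rm DP})$-critical.
   Context: Graphs are finite, undirected, may have multiple edges, no loops. $\mu_G(u,v)$ is the number of edges joining $u$ and $v$. A cover of $G$ is a pair $(X,H)$ where $H$ is a graph and $X$ assigns to each $v\in V(G)$ a set $X_v\subseteq V(H)$ such that the sets $X_v$ are pairwise disjoint, $V(H)=\bigcup_v X_v$, each $X_v$ is independent in $H$, and for distinct $u,v\in V(G)$ the set $E_H(X_u,X_v)$ of edges of $H$ between $X_u$ and $X_v$ is the union of $\mu_G(u,v)$ (possibly empty) matchings of $H$. It is a $k$-cover if $|X_v|\ge k$ for all $v$. A transversal of $(X,H)$ is a set $T\subseteq V(H)$ with $|T\cap X_v|=1$ for all $v\in V(G)$. A graph property is a class of graphs closed under isomorphism. It is non-trivial if it contains a non-empty graph but not all graphs; hereditary if closed under induced subgraphs; additive if closed under disjoint unions; reliable if non-trivial, hereditary and additive. A $\mathcal{P}$-transversal of $(X,H)$ is a transversal $T$ with $H[T]\in\mathcal{P}$. $\chi_{\rm DP}(G:\mathcal{P})$ is the least integer $k\ge 0$ such that every $k$-cover of $G$ has a $\mathcal{P}$-transversal. $G$ is $(\mathcal{P},\chi_{\rm DP})$-critical if every proper induced subgraph $G'$ of $G$ satisfies $\chi_{\rm DP}(G':\mathcal{P})<\chi_{\rm DP}(G:\mathcal{P})$.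 -}

module Defs where

open import Level using (Level) renaming (suc to lsuc)
open import Data.Bool using (Bool; true)
open import Data.Nat using (ℕ; zero; suc; _+_; _≤_; _<_)
open import Data.Fin as Fin using (Fin; zero; suc; splitAt)
open import Data.Fin.Subset using (Subset; inside; outside; ∣_∣; _∈_; _∩_; _⊂_; ⊤; Empty)
open import Data.Vec using ([]; _∷_)
open import Data.Product using (Σ; ∃; ∃₂; _×_; _,_)
open import Data.Sum using (_⊎_; inj₁; inj₂)
open import Function.Bundles using (_↔_; _⇔_; Inverse)
open import Relation.Nullary using (¬_)
open import Relation.Binary.PropositionalEquality using (_≡_; _≢_; refl)

-- A finite loopless multigraph on the vertex set Fin order, given by its
-- edge multiplicities.  The graph with no vertices is allowed.
record Graph : Set where
  field
    order    : ℕ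
    μ        : Fin order → Fin order → ℕ
    μ-sym    : ∀ u v → μ u v ≡ μ v u
    loopless : ∀ v → μ v v ≡ 0

open Graph public

V : Graph → Set
V G = Fin (order G)

-- Each undirected edge is represented once, by listing its smaller end first;
-- idx tells apart the parallel edges with the same ends.
record Edge (G : Graph) : Set where
  constructor edge
  field
    end₁ end₂ : V G
    .ordered  : end₁ Fin.< end₂
    idx       : Fin (μ G end₁ end₂)

EdgeSet : Graph → Set
EdgeSet G = Edge G → Bool

_∈ᴱ_ : ∀ {G} → Edge G → EdgeSet G → Set
e ∈ᴱ M = M e ≡ true

_IsEndOf_ : ∀ {G} → V G → Edge G → Set
x IsEndOf e = x ≡ Edge.end₁ e ⊎ x ≡ Edge.end₂ e

-- In particular a matching contains at most one edge of any parallel class.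
IsMatching : ∀ {G} → EdgeSet G → Set
IsMatching {G} M =
  ∀ (e f : Edge G) → e ∈ᴱ M → f ∈ᴱ M → (x : V G) → x IsEndOf e → x IsEndOf f → e ≡ f

-- e ∈ E_G(A , B)
Between : ∀ {G} → Subset (order G) → Subset (order G) → Edge G → Set
Between A B (edge x y _ _) = (x ∈ A × y ∈ B) ⊎ (y ∈ A × x ∈ B)

IsUnionOfMatchings : ∀ {G} → ℕ → (Edge G → Set) → Set
IsUnionOfMatchings {G} m F =
  Σ (Fin m → EdgeSet G) λ M →
    (∀ i → IsMatching (M i)) × (∀ e → F e ⇔ ∃ λ i → e ∈ᴱ M i)

-- The increasing enumeration of the elements of S.
elements : ∀ {n} (S : Subset n) → Fin ∣ S ∣ → Fin n
elements (outside ∷ S) i       = suc (elements S i)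
elements (inside  ∷ S) zero    = zero
elements (inside  ∷ S) (suc i) = suc (elements S i)

-- The subgraph induced by S, with its vertices renumbered along elements S.
_[_] : (G : Graph) → Subset (order G) → Graph
G [ S ] = record
  { order    = ∣ S ∣
  ; μ        = λ i j → μ G (elements S i) (elements S j)
  ; μ-sym    = λ i j → μ-sym G (elements S i) (elements S j)
  ; loopless = λ i → loopless G (elements S i)
  }

_⊎ᴳ_ : Graph → Graph → Graph
G ⊎ᴳ H = record
  { order    = order G + order H
  ; μ        = λ x y → m (splitAt (order G) x) (splitAt (order G) y)
  ; μ-sym    = λ x y → m-sym (splitAt (order G) x) (splitAt (order G) y)
  ; loopless = λ x → m-loopless (splitAt (order G) x)
  }
  where
  m : V G ⊎ V H → V G ⊎ V H → ℕ
  m (inj₁ u) (inj₁ v) = μ G u v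
  m (inj₂ u) (inj₂ v) = μ H u v
  m (inj₁ _) (inj₂ _) = 0
  m (inj₂ _) (inj₁ _) = 0

  m-sym : ∀ x y → m x y ≡ m y x
  m-sym (inj₁ u) (inj₁ v) = μ-sym G u v
  m-sym (inj₂ u) (inj₂ v) = μ-sym H u v
  m-sym (inj₁ _) (inj₂ _) = refl
  m-sym (inj₂ _) (inj₁ _) = refl

  m-loopless : ∀ x → m x x ≡ 0
  m-loopless (inj₁ v) = loopless G v
  m-loopless (inj₂ v) = loopless H v

_≅_ : Graph → Graph → Set
G ≅ H = Σ (V G ↔ V H) λ φ →
  ∀ u v → μ H (Inverse.to φ u) (Inverse.to φ v) ≡ μ G u v

record GraphProperty (ℓ : Level) : Set (lsuc ℓ) where
  field
    Has      : Graph → Set ℓ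
    respects : ∀ {G H} → G ≅ H → Has G → Has H

open GraphProperty public

module _ {ℓ : Level} (P : GraphProperty ℓ) where

  NonTrivial : Set ℓ
  NonTrivial = (∃ λ G → 0 < order G × Has P G) × ¬ (∀ G → Has P G)

  Hereditary : Set ℓ
  Hereditary = ∀ G (S : Subset (order G)) → Has P G → Has P (G [ S ])

  Additive : Set ℓ
  Additive = ∀ G H → Has P G → Has P H → Has P (G ⊎ᴳ H)

  Reliable : Set ℓ
  Reliable = NonTrivial × Hereditary × Additive

record Cover (G : Graph) : Set where
  field
    H           : Graph
    X           : V G → Subset (order H)
    disjoint    : ∀ u v → u ≢ v → Empty (X u ∩ X v)
    covering    : ∀ x → ∃ λ v → x ∈ X v
    independent : ∀ v x y → x ∈ X v → y ∈ X v → μ H x y ≡ 0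
    matchings   : ∀ u v → u ≢ v → IsUnionOfMatchings {H} (μ G u v) (Between (X u) (X v))

IsKCover : ∀ {G} → ℕ → Cover G → Set
IsKCover k C = ∀ v → k ≤ ∣ Cover.X C v ∣

IsTransversal : ∀ {G} (C : Cover G) → Subset (order (Cover.H C)) → Set
IsTransversal C T = ∀ v → ∣ T ∩ Cover.X C v ∣ ≡ 1

module _ {ℓ : Level} (P : GraphProperty ℓ) where

  HasPTransversal : ∀ {G} → Cover G → Set ℓ
  HasPTransversal C = ∃ λ T → IsTransversal C T × Has P (Cover.H C [ T ])

  EveryKCoverHasPTransversal : Graph → ℕ → Set ℓ
  EveryKCoverHasPTransversal G k = (C : Cover G) → IsKCover k C → HasPTransversal C

  -- χDP G k means χ_DP(G : P) = k.  Being a least element, such a k is unique,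
  -- so a relation R between the numbers χ_DP(G : P) and χ_DP(G' : P) is
  -- rendered as: χDP G k, χDP G' k' and R k k' hold for some k and k'.
  χDP : Graph → ℕ → Set ℓ
  χDP G k = EveryKCoverHasPTransversal G k
          × (∀ j → EveryKCoverHasPTransversal G j → k ≤ j)

  Critical : Graph → Set ℓ
  Critical G = (S : Subset (order G)) → S ⊂ ⊤ →
    ∃₂ λ j k → χDP (G [ S ]) j × χDP G k × j < k

{-# OPTIONS --safe #-}

-- χ_DP(G : P) is finite: if B bounds all edge multiplicities of G, then in a
-- (1 + |V(G)| B)-cover the chosen representatives of the other vertices block
-- at most |V(G)| B vertices of any X_v, so the representatives can be
-- rechosen one after another to form an edgeless transversal, and P contains
-- all edgeless graphs.  χ_DP is monotone under induced subgraphs: a k-cover of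
-- an induced subgraph extends to a k-cover of G by k isolated vertices for each
-- missing vertex of G, and P is hereditary.  Hence an induced subgraph of least
-- order among those with the same χ_DP as G is critical.
module Submission where

open import Defs
open import Axiom.ExcludedMiddle using (ExcludedMiddle)
open import Data.Bool using (false)
open import Data.Fin as Fin using (Fin; zero; suc; toℕ; fromℕ<; cast; combine; inject≤; quotient; splitAt; _↑ˡ_; _↑ʳ_)
open import Data.Fin.Properties as Fin using (_≟_; any?; all?; injective⇒≤; splitAt-↑ˡ; splitAt-↑ʳ; splitAt⁻¹-↑ˡ; splitAt⁻¹-↑ʳ; ↑ˡ-injective; ↑ʳ-injective; toℕ-↑ˡ; cast-involutive; toℕ-cast; toℕ-injective; toℕ-fromℕ<; toℕ<n; remQuot-combine; combine-injective; inject≤-injective; ¬∀⟶∃¬)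
open import Data.Fin.Subset using (Subset; inside; outside; ∣_∣; _∈_; _∩_; ⊤)
open import Data.Fin.Subset.Properties using (∈⊤; ∣⊤∣≡n; p⊂q⇒∣p∣<∣q∣; x∈p∩q⁺; x∈p∩q⁻; _∈?_)
open import Data.Nat using (ℕ; zero; suc; _+_; _*_; _⊔_; _≤_; _<_; s≤s)
open import Data.Nat.Induction using (Acc; acc; <-wellFounded)
open import Data.Nat.Properties as ℕ using (≤-trans; ≤-antisym; ≤-reflexive; ≤∧≢⇒<; ≮⇒≥; m≤m⊔n; m≤n⊔m; m<1+n⇒m<n∨m≡n)
open import Data.Product using (Σ; ∃; ∃₂; _×_; _,_; proj₁; proj₂)
open import Data.Sum using (_⊎_; inj₁; inj₂; [_,_])
open import Data.Vec using ([]; _∷_; here; there; tabulate)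
open import Data.Vec.Properties using (lookup∘tabulate; lookup⇒[]=; []=⇒lookup)
open import Function using (_∘_; id)
open import Function.Bundles using (_⇔_; mk⇔; mk↔ₛ′; Equivalence)
open import Function.Definitions using (Injective)
open import Relation.Binary.Definitions using (tri<; tri≈; tri>)
open import Relation.Binary.PropositionalEquality using (_≡_; _≢_; refl; sym; trans; cong; cong₂; subst)
open import Relation.Nullary using (¬_; Dec; yes; no; does; contradiction; ¬?)
open import Relation.Nullary.Decidable using (dec-true; _→-dec_; decidable-stable)
open import Relation.Nullary.Recomputable using (¬-recompute)

-- Subsets of Fin n

module _ {n} {p} {Q : Fin n → Set p} (Q? : ∀ x → Dec (Q x)) where

  comprehension : Subset n
  comprehension = tabulate (does ∘ Q?)

  ∈-comprehension⁺ : ∀ {x} → Q x → x ∈ comprehension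
  ∈-comprehension⁺ {x} q =
    lookup⇒[]= x _ (trans (lookup∘tabulate _ x) (dec-true (Q? x) q))

  ∈-comprehension⁻ : ∀ {x} → x ∈ comprehension → Q x
  ∈-comprehension⁻ {x} x∈ with Q? x | trans (sym (lookup∘tabulate (does ∘ Q?) x)) ([]=⇒lookup x∈)
  ... | yes q | _ = q
  ... | no _  | ()

elements-∈ : ∀ {n} (S : Subset n) i → elements S i ∈ S
elements-∈ (outside ∷ S) i       = there (elements-∈ S i)
elements-∈ (inside  ∷ S) zero    = here
elements-∈ (inside  ∷ S) (suc i) = there (elements-∈ S i)

elements-injective : ∀ {n} (S : Subset n) → Injective _≡_ _≡_ (elements S)
elements-injective (outside ∷ S) eq = elements-injective S (Fin.suc-injective eq)
elements-injective (inside  ∷ S) {zero}  {zero}  eq = refl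
elements-injective (inside  ∷ S) {suc i} {suc j} eq =
  cong suc (elements-injective S (Fin.suc-injective eq))

position : ∀ {n} (S : Subset n) {x} → x ∈ S → ∃ λ i → elements S i ≡ x
position (inside  ∷ S) here = zero , refl
position (inside  ∷ S) (there x∈S) with i , eq ← position S x∈S = suc i , cong suc eq
position (outside ∷ S) (there x∈S) with i , eq ← position S x∈S = i , cong suc eq

injection⇒≤∣∣ : ∀ {n k} (S : Subset n) (g : Fin k → Fin n) →
  Injective _≡_ _≡_ g → (∀ i → g i ∈ S) → k ≤ ∣ S ∣
injection⇒≤∣∣ S g g-inj g∈S = injective⇒≤ {f = proj₁ ∘ pos} λ {i} {j} eq →
  g-inj (trans (sym (proj₂ (pos i))) (trans (cong (elements S) eq) (proj₂ (pos j))))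
  where
  pos : ∀ i → ∃ λ j → elements S j ≡ g i
  pos i = position S (g∈S i)

IsUniqueElement : ∀ {n} → Subset n → Fin n → Set
IsUniqueElement S x = x ∈ S × (∀ {y} → y ∈ S → y ≡ x)

∣∣≡1⇒unique : ∀ {n} (S : Subset n) → ∣ S ∣ ≡ 1 → ∃ (IsUniqueElement S)
-- Abstracting the cardinality together with everything indexed by it lets `refl` turn the index
-- type into `Fin 1`.
∣∣≡1⇒unique S eq with ∣ S ∣ | elements S | elements-∈ S | position S
∣∣≡1⇒unique S refl | _ | el | el∈S | pos = el zero , el∈S zero , λ y∈S → unique (pos y∈S)
  where
  unique : ∀ {y} → (∃ λ i → el i ≡ y) → y ≡ el zero
  unique (zero , eq) = sym eq

unique⇒∣∣≡1 : ∀ {n} (S : Subset n) {x} → IsUniqueElement S x → ∣ S ∣ ≡ 1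
unique⇒∣∣≡1 S {x} (x∈S , unique) = ≤-antisym
  (injective⇒≤ {f = λ (_ : Fin ∣ S ∣) → zero {0}} λ {i} {j} _ → elements-injective S
    (trans (unique (elements-∈ S i)) (sym (unique (elements-∈ S j)))))
  (injection⇒≤∣∣ S (λ (_ : Fin 1) → x) (λ { {zero} {zero} _ → refl }) (λ _ → x∈S))

-- The image of `R` under `elements S`, by recursion on `S` so that the two enumerations can be
-- compared one element at a time.
subsetOfSubset : ∀ {n} (S : Subset n) → Subset ∣ S ∣ → Subset n
subsetOfSubset []            _       = []
subsetOfSubset (outside ∷ S) R       = outside ∷ subsetOfSubset S R
subsetOfSubset (inside  ∷ S) (b ∷ R) = b ∷ subsetOfSubset S R

∣subsetOfSubset∣ : ∀ {n} (S : Subset n) R → ∣ R ∣ ≡ ∣ subsetOfSubset S R ∣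
∣subsetOfSubset∣ []            []            = refl
∣subsetOfSubset∣ (outside ∷ S) R             = ∣subsetOfSubset∣ S R
∣subsetOfSubset∣ (inside  ∷ S) (outside ∷ R) = ∣subsetOfSubset∣ S R
∣subsetOfSubset∣ (inside  ∷ S) (inside  ∷ R) = cong suc (∣subsetOfSubset∣ S R)

elements-subsetOfSubset : ∀ {n} (S : Subset n) R .(eq : ∣ R ∣ ≡ ∣ subsetOfSubset S R ∣) i →
  elements (subsetOfSubset S R) (cast eq i) ≡ elements S (elements R i)
elements-subsetOfSubset []            []            eq ()
elements-subsetOfSubset (outside ∷ S) R             eq i = cong suc (elements-subsetOfSubset S R eq i)
elements-subsetOfSubset (inside  ∷ S) (outside ∷ R) eq i = cong suc (elements-subsetOfSubset S R eq i)
elements-subsetOfSubset (inside  ∷ S) (inside  ∷ R) eq zero    = refl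
elements-subsetOfSubset (inside  ∷ S) (inside  ∷ R) eq (suc i) =
  cong suc (elements-subsetOfSubset S R (ℕ.suc-injective eq) i)

splitAt-view : ∀ m {n} (x : Fin (m + n)) → (∃ λ y → y ↑ˡ n ≡ x) ⊎ (∃ λ z → m ↑ʳ z ≡ x)
splitAt-view m x with splitAt m x in eq
... | inj₁ y = inj₁ (y , splitAt⁻¹-↑ˡ eq)
... | inj₂ z = inj₂ (z , splitAt⁻¹-↑ʳ eq)

-- Induced embeddings

infix 4 _↪_

-- An isomorphism onto an induced subgraph: multiplicities agree exactly, so non-adjacency is
-- preserved too.
record _↪_ (G H : Graph) : Set where
  field
    to        : V G → V H
    injective : Injective _≡_ _≡_ to
    μ-to      : ∀ u v → μ H (to u) (to v) ≡ μ G u v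

elements-↪ : ∀ G S → G [ S ] ↪ G
elements-↪ G S = record
  { to = elements S ; injective = elements-injective S ; μ-to = λ _ _ → refl }

↪-restrict : ∀ {G H} (f : G ↪ H) (S : Subset (order H)) →
  (∀ v → _↪_.to f v ∈ S) → G ↪ H [ S ]
↪-restrict {G} {H} f S f∈S = record
  { to        = proj₁ ∘ pos
  ; injective = λ {u} {v} eq → injective
      (trans (sym (proj₂ (pos u))) (trans (cong (elements S) eq) (proj₂ (pos v))))
  ; μ-to      = λ u v → trans (cong₂ (μ H) (proj₂ (pos u)) (proj₂ (pos v))) (μ-to u v)
  }
  where
  open _↪_ f
  pos : ∀ v → ∃ λ i → elements S i ≡ to v
  pos v = position S (f∈S v)

id-↪ : ∀ G → G ↪ G
id-↪ G = record { to = id ; injective = id ; μ-to = λ _ _ → refl }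

-- Both sides list the same vertices of `G` in increasing order, so a vertex keeps its number and
-- only the bound on it is cast.
induced-induced-↪ : ∀ G S R → (G [ S ]) [ R ] ↪ G [ subsetOfSubset S R ]
induced-induced-↪ G S R = record
  { to        = cast eq
  ; injective = λ {i} {j} e → toℕ-injective
      (trans (sym (toℕ-cast eq i)) (trans (cong toℕ e) (toℕ-cast eq j)))
  ; μ-to      = λ i j → cong₂ (μ G) (elements-subsetOfSubset S R eq i) (elements-subsetOfSubset S R eq j)
  }
  where
  eq : ∣ R ∣ ≡ ∣ subsetOfSubset S R ∣
  eq = ∣subsetOfSubset∣ S R

-- Hereditary and reliable properties

edgeless : ℕ → Graph
edgeless n = record
  { order = n ; μ = λ _ _ → 0 ; μ-sym = λ _ _ → refl ; loopless = λ _ → refl }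

module _ {ℓ} (P : GraphProperty ℓ) (hereditary : Hereditary P) where

  -- `Hereditary` speaks of graphs of the form `H [ S ]` only. With `S` the image of the embedding,
  -- `G` is isomorphic to such a graph, and `respects` carries the property over.
  hereditary-↪ : ∀ {G H} → G ↪ H → Has P H → Has P G
  hereditary-↪ {G} {H} f hasH = respects P (φ , φ-μ) (hereditary H image hasH)
    where
    open _↪_ f

    image? : ∀ x → Dec (∃ λ v → to v ≡ x)
    image? x = any? λ v → to v ≟ x

    image : Subset (order H)
    image = comprehension image?

    preimage : ∀ i → ∃ λ v → to v ≡ elements image i
    preimage i = ∈-comprehension⁻ image? (elements-∈ image i)

    pos : ∀ v → ∃ λ i → elements image i ≡ to v
    pos v = position image (∈-comprehension⁺ image? (v , refl))

    φ = mk↔ₛ′ (proj₁ ∘ preimage) (proj₁ ∘ pos)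
      (λ v → injective (trans (proj₂ (preimage (proj₁ (pos v)))) (proj₂ (pos v))))
      (λ i → elements-injective image
        (trans (proj₂ (pos (proj₁ (preimage i)))) (proj₂ (preimage i))))

    φ-μ : ∀ i j → μ G (proj₁ (preimage i)) (proj₁ (preimage j)) ≡ μ (H [ image ]) i j
    φ-μ i j = trans (sym (μ-to _ _)) (cong₂ (μ H) (proj₂ (preimage i)) (proj₂ (preimage j)))

  module _ (nonTrivial : NonTrivial P) (additive : Additive P) where

    -- Any vertex of a non-empty member of `P` induces a one-vertex member; disjoint unions then add
    -- one vertex at a time. The empty graph embeds in every member.
    edgeless-has : ∀ n → Has P (edgeless n)
    edgeless-has zero with G , _ , hasG ← proj₁ nonTrivial =
      hereditary-↪ {H = G} (record { to = λ () ; injective = λ { {()} } ; μ-to = λ () }) hasG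
    edgeless-has (suc n) with G , 0<∣G∣ , hasG ← proj₁ nonTrivial =
      hereditary-↪ (record { to = id ; injective = id ; μ-to = μ≡0 })
        (additive (edgeless 1) (edgeless n) (hereditary-↪ vertex hasG) (edgeless-has n))
      where
      vertex : edgeless 1 ↪ G
      vertex = record
        { to        = λ _ → fromℕ< 0<∣G∣
        ; injective = λ { {zero} {zero} _ → refl }
        ; μ-to      = λ _ _ → loopless G _
        }

      μ≡0 : ∀ x y → μ (edgeless 1 ⊎ᴳ edgeless n) x y ≡ 0
      μ≡0 x y with splitAt 1 x | splitAt 1 y
      ... | inj₁ _ | inj₁ _ = refl
      ... | inj₁ _ | inj₂ _ = refl
      ... | inj₂ _ | inj₁ _ = refl
      ... | inj₂ _ | inj₂ _ = refl

    μ≡0⇒has : ∀ G → (∀ u v → μ G u v ≡ 0) → Has P G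
    μ≡0⇒has G μ≡0 = hereditary-↪
      (record { to = id ; injective = id ; μ-to = λ u v → sym (μ≡0 u v) })
      (edgeless-has (order G))

module _ {G} (C : Cover G) where
  open Cover C

  ∈-X-unique : ∀ {u v x} → x ∈ X u → x ∈ X v → u ≡ v
  ∈-X-unique {u} {v} {x} x∈Xu x∈Xv = decidable-stable (u ≟ v) λ u≢v →
    disjoint u v u≢v (x , x∈p∩q⁺ (x∈Xu , x∈Xv))

-- Extension of a cover along an induced embedding

module Extension {G′ G} (f : G′ ↪ G) (C : Cover G′) (k : ℕ) where
  open _↪_ f
  open Cover C

  image? : ∀ v → Dec (∃ λ a → to a ≡ v)
  image? v = any? λ a → to a ≟ v

  missing? : ∀ v → Dec (¬ ∃ λ a → to a ≡ v)
  missing? v = ¬? (image? v)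

  missing : Subset (order G)
  missing = comprehension missing?

  -- One block of `k` isolated vertices per missing vertex of `G`; `combine` and `quotient`
  -- translate between a vertex and its block.
  extra : ℕ
  extra = ∣ missing ∣ * k

  H⁺ : Graph
  H⁺ = H ⊎ᴳ edgeless extra

  μ-↑ˡ-↑ˡ : ∀ x y → μ H⁺ (x ↑ˡ extra) (y ↑ˡ extra) ≡ μ H x y
  μ-↑ˡ-↑ˡ x y rewrite splitAt-↑ˡ (order H) x extra | splitAt-↑ˡ (order H) y extra = refl

  μ-↑ʳ : ∀ z y → μ H⁺ (order H ↑ʳ z) y ≡ 0
  μ-↑ʳ z y rewrite splitAt-↑ʳ (order H) extra z with splitAt (order H) y
  ... | inj₁ _ = refl
  ... | inj₂ _ = refl

  owner : V H → V G′
  owner x = proj₁ (covering x)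

  owner-∈ : ∀ x → x ∈ X (owner x)
  owner-∈ x = proj₂ (covering x)

  extraOwner : Fin extra → V G
  extraOwner z = elements missing (quotient k z)

  extraOwner-missing : ∀ z a → to a ≢ extraOwner z
  extraOwner-missing z a eq = ∈-comprehension⁻ missing? (elements-∈ missing (quotient k z)) (a , eq)

  -- The new cover sets are the fibres of this map, which makes them disjoint and covering by
  -- construction.
  owner⁺ : V H⁺ → V G
  owner⁺ x = [ to ∘ owner , extraOwner ] (splitAt (order H) x)

  owner⁺-↑ˡ : ∀ x → owner⁺ (x ↑ˡ extra) ≡ to (owner x)
  owner⁺-↑ˡ x rewrite splitAt-↑ˡ (order H) x extra = refl

  owner⁺-↑ʳ : ∀ z → owner⁺ (order H ↑ʳ z) ≡ extraOwner z
  owner⁺-↑ʳ z rewrite splitAt-↑ʳ (order H) extra z = refl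

  fibre? : ∀ v x → Dec (owner⁺ x ≡ v)
  fibre? v x = owner⁺ x ≟ v

  X⁺ : V G → Subset (order H⁺)
  X⁺ v = comprehension (fibre? v)

  ↑ˡ-∈⁺ : ∀ {a x} → x ∈ X a → x ↑ˡ extra ∈ X⁺ (to a)
  ↑ˡ-∈⁺ {a} {x} x∈Xa = ∈-comprehension⁺ (fibre? (to a))
    (trans (owner⁺-↑ˡ x) (cong to (∈-X-unique C (owner-∈ x) x∈Xa)))

  ↑ˡ-∈⁻ : ∀ {a x} → x ↑ˡ extra ∈ X⁺ (to a) → x ∈ X a
  ↑ˡ-∈⁻ {a} {x} x∈ = subst (λ b → x ∈ X b)
    (injective (trans (sym (owner⁺-↑ˡ x)) (∈-comprehension⁻ (fibre? (to a)) x∈))) (owner-∈ x)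

  ↑ˡ-∉ : ∀ {v x} → (¬ ∃ λ a → to a ≡ v) → ¬ x ↑ˡ extra ∈ X⁺ v
  ↑ˡ-∉ {v} {x} v∉ x∈ = v∉ (owner x , trans (sym (owner⁺-↑ˡ x)) (∈-comprehension⁻ (fibre? v) x∈))

  ↑ʳ-∉ : ∀ {a z} → ¬ order H ↑ʳ z ∈ X⁺ (to a)
  ↑ʳ-∉ {a} {z} z∈ = extraOwner-missing z a
    (trans (sym (∈-comprehension⁻ (fibre? (to a)) z∈)) (owner⁺-↑ʳ z))

  liftEdge : Edge H → Edge H⁺
  liftEdge (edge x y x<y i) = edge (x ↑ˡ extra) (y ↑ˡ extra)
    (≤-trans (s≤s (≤-reflexive (toℕ-↑ˡ x extra))) (≤-trans x<y (≤-reflexive (sym (toℕ-↑ˡ y extra)))))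
    (cast (sym (μ-↑ˡ-↑ˡ x y)) i)

  -- An edge with an end among the added vertices would have its index in `Fin 0`, so every edge of
  -- `H⁺` comes from `H`.
  unliftEdge : ∀ e → ∃ λ d → liftEdge d ≡ e
  unliftEdge (edge x y x<y i) with splitAt-view (order H) x | splitAt-view (order H) y
  ... | inj₂ (z , refl) | _ with () ← subst Fin (μ-↑ʳ z y) i
  ... | inj₁ _ | inj₂ (z , refl) with () ← subst Fin (trans (μ-sym H⁺ x _) (μ-↑ʳ z x)) i
  ... | inj₁ (x′ , refl) | inj₁ (y′ , refl) =
    edge x′ y′
      (≤-trans (s≤s (≤-reflexive (sym (toℕ-↑ˡ x′ extra)))) (≤-trans x<y (≤-reflexive (toℕ-↑ˡ y′ extra))))
      (cast (μ-↑ˡ-↑ˡ x′ y′) i) ,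
    -- The order proof is irrelevant, so only the indices have to be matched.
    cong (edge _ _ x<y) (cast-involutive (sym (μ-↑ˡ-↑ˡ x′ y′)) (μ-↑ˡ-↑ˡ x′ y′) i)

  IsEndOf-unlift : ∀ {x d} → x IsEndOf liftEdge d → ∃ λ y → y ↑ˡ extra ≡ x × y IsEndOf d
  IsEndOf-unlift (inj₁ eq) = _ , sym eq , inj₁ refl
  IsEndOf-unlift (inj₂ eq) = _ , sym eq , inj₂ refl

  liftMatching : EdgeSet H → EdgeSet H⁺
  liftMatching M e = M (proj₁ (unliftEdge e))

  -- Two edges of `H⁺` with a common end are lifts, and that end is the lift of a common end in `H`,
  -- where `M` is a matching.
  liftMatching-isMatching : ∀ {M} → IsMatching M → IsMatching (liftMatching M)
  liftMatching-isMatching matching e e′ e∈ e′∈ x x∈e x∈e′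
    with unliftEdge e | unliftEdge e′
  ... | d , refl | d′ , refl
    with y , refl , y∈d ← IsEndOf-unlift {d = d} x∈e
       | y′ , eq , y′∈d′ ← IsEndOf-unlift {d = d′} x∈e′
    with refl ← ↑ˡ-injective extra y′ y eq =
    cong liftEdge (matching d d′ e∈ e′∈ y y∈d y′∈d′)

  Between-lift : ∀ a b d → Between {H} (X a) (X b) d ⇔ Between {H⁺} (X⁺ (to a)) (X⁺ (to b)) (liftEdge d)
  Between-lift a b d = mk⇔
    (λ { (inj₁ (p , q)) → inj₁ (↑ˡ-∈⁺ p , ↑ˡ-∈⁺ q) ; (inj₂ (p , q)) → inj₂ (↑ˡ-∈⁺ p , ↑ˡ-∈⁺ q) })
    (λ { (inj₁ (p , q)) → inj₁ (↑ˡ-∈⁻ p , ↑ˡ-∈⁻ q) ; (inj₂ (p , q)) → inj₂ (↑ˡ-∈⁻ p , ↑ˡ-∈⁻ q) })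

  ¬Between : ∀ {u v} → (¬ ∃ λ a → to a ≡ u) ⊎ (¬ ∃ λ a → to a ≡ v) →
    ∀ e → ¬ Between {H⁺} (X⁺ u) (X⁺ v) e
  ¬Between u∉⊎v∉ e between with unliftEdge e
  ¬Between (inj₁ u∉) e (inj₁ (p , _)) | d , refl = ↑ˡ-∉ u∉ p
  ¬Between (inj₁ u∉) e (inj₂ (p , _)) | d , refl = ↑ˡ-∉ u∉ p
  ¬Between (inj₂ v∉) e (inj₁ (_ , q)) | d , refl = ↑ˡ-∉ v∉ q
  ¬Between (inj₂ v∉) e (inj₂ (_ , q)) | d , refl = ↑ˡ-∉ v∉ q

  empty-isUnionOfMatchings : ∀ {m F} → (∀ e → ¬ F e) → IsUnionOfMatchings {H⁺} m F
  empty-isUnionOfMatchings ¬F =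
    (λ _ _ → false) , (λ _ _ _ ()) , λ e → mk⇔ (λ Fe → contradiction Fe (¬F e)) λ ()

  matchings⁺ : ∀ u v → u ≢ v → IsUnionOfMatchings {H⁺} (μ G u v) (Between (X⁺ u) (X⁺ v))
  matchings⁺ u v u≢v with image? u | image? v
  -- A missing vertex owns isolated vertices only, so there is no edge to cover and empty matchings
  -- serve for any multiplicity.
  ... | no u∉ | _     = empty-isUnionOfMatchings (¬Between (inj₁ u∉))
  ... | yes _ | no v∉ = empty-isUnionOfMatchings (¬Between (inj₂ v∉))
  ... | yes (a , refl) | yes (b , refl)
    with M , M-matching , M-union ← matchings a b (u≢v ∘ cong to) =
    -- The embedding preserves multiplicity, so the cover of `G′` supplies exactly the required
    -- number of matchings.
    subst (λ m → IsUnionOfMatchings {H⁺} m (Between (X⁺ u) (X⁺ v))) (sym (μ-to a b))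
      (liftMatching ∘ M , liftMatching-isMatching ∘ M-matching , union)
    where
    union : ∀ e → Between {H⁺} (X⁺ u) (X⁺ v) e ⇔ ∃ λ i → e ∈ᴱ liftMatching (M i)
    union e with unliftEdge e
    ... | d , refl = mk⇔
      (Equivalence.to (M-union d) ∘ Equivalence.from (Between-lift a b d))
      (Equivalence.to (Between-lift a b d) ∘ Equivalence.from (M-union d))

  independent⁺ : ∀ v x y → x ∈ X⁺ v → y ∈ X⁺ v → μ H⁺ x y ≡ 0
  independent⁺ v x y x∈ y∈ with splitAt-view (order H) x | splitAt-view (order H) y
  ... | inj₂ (z , refl) | _ = μ-↑ʳ z y
  ... | inj₁ _ | inj₂ (z , refl) = trans (μ-sym H⁺ x _) (μ-↑ʳ z x)
  ... | inj₁ (x′ , refl) | inj₁ (y′ , refl) with image? v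
  ... | no v∉ = contradiction x∈ (↑ˡ-∉ v∉)
  ... | yes (a , refl) =
    trans (μ-↑ˡ-↑ˡ x′ y′) (independent a x′ y′ (↑ˡ-∈⁻ x∈) (↑ˡ-∈⁻ y∈))

  cover : Cover G
  cover = record
    { H           = H⁺
    ; X           = X⁺
    ; disjoint    = λ u v u≢v (x , x∈) → u≢v (trans
        (sym (∈-comprehension⁻ (fibre? u) (proj₁ (x∈p∩q⁻ (X⁺ u) (X⁺ v) x∈))))
        (∈-comprehension⁻ (fibre? v) (proj₂ (x∈p∩q⁻ (X⁺ u) (X⁺ v) x∈))))
    ; covering    = λ x → owner⁺ x , ∈-comprehension⁺ (fibre? (owner⁺ x)) refl
    ; independent = independent⁺
    ; matchings   = matchings⁺
    }

  cover-isKCover : IsKCover k C → IsKCover k cover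
  cover-isKCover kCover v with image? v
  ... | yes (a , refl) = ≤-trans (kCover a) (injection⇒≤∣∣ (X⁺ v)
    (λ i → elements (X a) i ↑ˡ extra)
    (λ eq → elements-injective (X a) (↑ˡ-injective extra _ _ eq))
    (λ i → ↑ˡ-∈⁺ (elements-∈ (X a) i)))
  -- The block numbered by the position of `v` among the missing vertices supplies the `k` elements.
  ... | no v∉ with c , refl ← position missing (∈-comprehension⁺ missing? v∉) =
    injection⇒≤∣∣ (X⁺ v)
    (λ i → order H ↑ʳ combine c i)
    (λ {i} {j} eq → proj₂ (combine-injective c i c j (↑ʳ-injective (order H) _ _ eq)))
    (λ i → ∈-comprehension⁺ (fibre? v) (trans (owner⁺-↑ʳ (combine c i))
      (cong (elements missing ∘ proj₁) (remQuot-combine c i))))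

  module _ {ℓ} (P : GraphProperty ℓ) (hereditary : Hereditary P) where

    -- The trace of `T⁺` on `H` works: the set of a vertex in the image contains no added vertex, so
    -- its representative lies in `H`, and `H [ T ]` embeds in `H⁺ [ T⁺ ]`.
    restrict-PTransversal : HasPTransversal P cover → HasPTransversal P C
    restrict-PTransversal (T⁺ , transversal , has) =
      T , (λ a → isTransversal a (∣∣≡1⇒unique _ (transversal (to a)))) ,
      hereditary-↪ P hereditary
        (↪-restrict inclusion T⁺ (λ i → ∈-comprehension⁻ T? (elements-∈ T i))) has
      where
      T? : ∀ x → Dec (x ↑ˡ extra ∈ T⁺)
      T? x = (x ↑ˡ extra) ∈? T⁺

      T : Subset (order H)
      T = comprehension T?

      inclusion : H [ T ] ↪ H⁺
      inclusion = record
        { to        = λ i → elements T i ↑ˡ extra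
        ; injective = λ eq → elements-injective T (↑ˡ-injective extra _ _ eq)
        ; μ-to      = λ i j → μ-↑ˡ-↑ˡ (elements T i) (elements T j)
        }

      isTransversal : ∀ a → ∃ (IsUniqueElement (T⁺ ∩ X⁺ (to a))) → ∣ T ∩ X a ∣ ≡ 1
      isTransversal a (x , x∈ , unique) with splitAt-view (order H) x | x∈p∩q⁻ T⁺ (X⁺ (to a)) x∈
      ... | inj₂ (z , refl) | _ , x∈X = contradiction x∈X ↑ʳ-∉
      ... | inj₁ (y , refl) | x∈T , x∈X = unique⇒∣∣≡1 (T ∩ X a)
        ( x∈p∩q⁺ (∈-comprehension⁺ T? x∈T , ↑ˡ-∈⁻ x∈X)
        , λ {y′} y′∈ → let y′∈T , y′∈X = x∈p∩q⁻ T (X a) y′∈ in ↑ˡ-injective extra y′ y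
            (unique (x∈p∩q⁺ (∈-comprehension⁻ T? y′∈T , ↑ˡ-∈⁺ y′∈X))))

-- Monotonicity of χDP under induced embeddings

everyKCover-↪ : ∀ {ℓ} (P : GraphProperty ℓ) → Hereditary P → ∀ {G′ G k} → G′ ↪ G →
  EveryKCoverHasPTransversal P G k → EveryKCoverHasPTransversal P G′ k
everyKCover-↪ P hereditary {k = k} f every C kCover =
  restrict-PTransversal P hereditary (every cover (cover-isKCover kCover))
  where open Extension f C k

χDP-mono-↪ : ∀ {ℓ} (P : GraphProperty ℓ) → Hereditary P → ∀ {G′ G j k} → G′ ↪ G →
  χDP P G′ j → χDP P G k → j ≤ k
χDP-mono-↪ P hereditary f (_ , least) (every , _) = least _ (everyKCover-↪ P hereditary f every)

-- Finiteness of χDP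

bounded : ∀ {n} (g : Fin n → ℕ) → ∃ λ b → ∀ i → g i ≤ b
bounded {zero}  g = 0 , λ ()
bounded {suc n} g with b , g≤b ← bounded (g ∘ suc) = g zero ⊔ b , λ
  { zero    → m≤m⊔n (g zero) b
  ; (suc i) → ≤-trans (g≤b i) (m≤n⊔m (g zero) b) }

μ-bounded : ∀ G → ∃ λ b → ∀ u v → μ G u v ≤ b
μ-bounded G with b , row≤b ← bounded (λ u → proj₁ (bounded (μ G u))) =
  b , λ u v → ≤-trans (proj₂ (bounded (μ G u)) v) (row≤b u)

-- Edges are stored with the smaller end first, so adjacency of two given vertices has to allow both
-- orders.
Joins : ∀ {G} → Edge G → V G → V G → Set
Joins e x y = (Edge.end₁ e ≡ x × Edge.end₂ e ≡ y) ⊎ (Edge.end₁ e ≡ y × Edge.end₂ e ≡ x)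

Joins-functional : ∀ {G} (e : Edge G) {x y z} → Joins e x y → Joins e x z → y ≡ z
Joins-functional e (inj₁ (_ , p))    (inj₁ (_ , q))    = trans (sym p) q
Joins-functional e (inj₁ (p , p′))   (inj₂ (q , q′))   = trans (trans (sym p′) q′) (trans (sym p) q)
Joins-functional e (inj₂ (p , p′))   (inj₁ (q , q′))   = trans (trans (sym p) q) (trans (sym p′) q′)
Joins-functional e (inj₂ (p , _))    (inj₂ (q , _))    = trans (sym p) q

Joins⇒IsEndOf : ∀ {G} {e : Edge G} {x y} → Joins e x y → x IsEndOf e
Joins⇒IsEndOf (inj₁ (p , _)) = inj₁ (sym p)
Joins⇒IsEndOf (inj₂ (_ , p)) = inj₂ (sym p)

Joins⇒Between : ∀ {G} {e : Edge G} {A B x y} → x ∈ A → y ∈ B → Joins e x y → Between {G} A B e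
Joins⇒Between x∈A y∈B (inj₁ (refl , refl)) = inj₁ (x∈A , y∈B)
Joins⇒Between x∈A y∈B (inj₂ (refl , refl)) = inj₂ (x∈A , y∈B)

≢0⇒Fin : ∀ {n} → n ≢ 0 → Fin n
≢0⇒Fin {zero}  n≢0 = contradiction refl n≢0
≢0⇒Fin {suc n} _   = zero

μ≢0⇒edge : ∀ G x y → μ G x y ≢ 0 → ∃ λ (e : Edge G) → Joins e x y
μ≢0⇒edge G x y μ≢0 with Fin.<-cmp x y
... | tri< x<y _ _  = edge x y x<y (≢0⇒Fin μ≢0) , inj₁ (refl , refl)
... | tri≈ _ refl _ = contradiction (loopless G x) μ≢0
... | tri> _ _ y<x  = edge y x y<x (≢0⇒Fin (μ≢0 ∘ trans (μ-sym G x y))) , inj₂ (refl , refl)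

module _ {G} (C : Cover G) {b} (μ≤b : ∀ u v → μ G u v ≤ b)
         (kCover : IsKCover (suc (order G * b)) C) where
  open Cover C

  Choice : Set
  Choice = Σ (V G → V H) λ c → ∀ v → c v ∈ X v

  module _ (choice : Choice) (v : V G) where

    private
      c : V G → V H
      c = proj₁ choice

    -- The present representative of `v` is left out because `x` is to replace it.
    Free : V H → Set
    Free x = ∀ u → u ≢ v → μ H (c u) x ≡ 0

    free? : ∀ x → Dec (Free x)
    free? x = all? λ u → ¬? (u ≟ v) →-dec (μ H (c u) x ℕ.≟ 0)

    -- Irrelevance of u≢v makes the chosen matchings independent of that proof.
    matchingsTo : ∀ u → .(u ≢ v) → IsUnionOfMatchings {H} (μ G u v) (Between (X u) (X v))
    matchingsTo u u≢v = matchings u v (¬-recompute u≢v)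

    -- A reason why `x` is not free, with the matching that contains the offending edge. A matching
    -- has at most one edge at `c u`, so `u` and `i` determine `x`.
    record Blocked (x : V H) : Set where
      field
        u    : V G
        .u≢v : u ≢ v
        i    : Fin (μ G u v)
        e    : Edge H
        e∈M  : e ∈ᴱ proj₁ (matchingsTo u u≢v) i
        join : Joins e (c u) x

    ¬free⇒blocked : ∀ {x} → x ∈ X v → ¬ Free x → Blocked x
    ¬free⇒blocked {x} x∈Xv ¬free
      with u , ¬ux ← ¬∀⟶∃¬ _ _ (λ u → ¬? (u ≟ v) →-dec (μ H (c u) x ℕ.≟ 0)) ¬free
      with u ≟ v
    ... | yes u≡v = contradiction (λ u≢v → contradiction u≡v u≢v) ¬ux
    ... | no u≢v
      with e , join ← μ≢0⇒edge H (c u) x (λ μ≡0 → ¬ux λ _ → μ≡0)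
      with i , e∈M ← Equivalence.to (proj₂ (proj₂ (matchingsTo u u≢v)) e)
                       (Joins⇒Between {e = e} (proj₂ choice u) x∈Xv join) =
      record { u = u ; u≢v = u≢v ; i = i ; e = e ; e∈M = e∈M ; join = join }

    -- The pair of `u` and `i`, with the matching index padded from `μ G u v` to the uniform bound
    -- `b`.
    code : ∀ {x} → Blocked x → Fin (order G * b)
    code β = combine (Blocked.u β) (inject≤ (Blocked.i β) (μ≤b (Blocked.u β) v))

    -- Equal codes put both edges in one matching, and both end at `c u`; hence they are the same
    -- edge, with the same other end.
    code-injective : ∀ {x y} (β : Blocked x) (γ : Blocked y) → code β ≡ code γ → x ≡ y
    code-injective β@record { u = u ; u≢v = u≢v ; i = i } γ eq
      with combine-injective u _ (Blocked.u γ) _ eq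
    ... | refl , eq′
      with refl ← inject≤-injective (μ≤b u v) (μ≤b u v) i (Blocked.i γ) eq′
      with refl ← proj₁ (proj₂ (matchingsTo u u≢v)) i _ _ (Blocked.e∈M β) (Blocked.e∈M γ) (c u)
                    (Joins⇒IsEndOf {e = Blocked.e β} (Blocked.join β))
                    (Joins⇒IsEndOf {e = Blocked.e γ} (Blocked.join γ)) =
      Joins-functional (Blocked.e β) (Blocked.join β) (Blocked.join γ)

    -- Pigeonhole: if every vertex of `X v` were blocked, `code` would inject more than
    -- `order G * b` vertices into `Fin (order G * b)`.
    free-exists : ∃ λ x → x ∈ X v × Free x
    free-exists with any? (λ i → free? (elements (X v) i))
    ... | yes (i , free) = elements (X v) i , elements-∈ (X v) i , free
    ... | no ¬free = contradiction
      (≤-trans (kCover v) (injective⇒≤ {f = λ i → code (β i)} λ {i} {j} eq →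
        elements-injective (X v) (code-injective (β i) (β j) eq)))
      ℕ.1+n≰n
      where
      β : ∀ i → Blocked (elements (X v) i)
      β i = ¬free⇒blocked (elements-∈ (X v) i) (λ free → ¬free (i , free))

  -- The invariant of the rechoosing: the first `m` representatives span no edge, while the later
  -- ones are arbitrary.
  IndependentBelow : ℕ → Choice → Set
  IndependentBelow m (c , _) = ∀ u v → toℕ u < m → toℕ v < m → μ H (c u) (c v) ≡ 0

  initialChoice : Choice
  initialChoice = (λ v → elements (X v) (first v)) , λ v → elements-∈ (X v) (first v)
    where
    first : ∀ v → Fin ∣ X v ∣
    -- The successor in the cover bound makes every `X v` non-empty, even when `order G * b` is
    -- zero.
    first v = inject≤ {suc (order G * b)} zero (kCover v)

  -- Only the representative of vertex number `m` changes. The new one is free of edges to all other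
  -- representatives, so the earlier ones keep the invariant.
  rechoose : ∀ {m} (choice : Choice) → m < order G → IndependentBelow m choice →
    ∃ (IndependentBelow (suc m))
  rechoose {m} choice@(c , c∈X) m<n indep with free-exists choice (fromℕ< m<n)
  ... | x , x∈X , free = (c′ , c′∈X) , indep′
    where
    w : V G
    w = fromℕ< m<n

    c′ : V G → V H
    c′ u with u ≟ w
    ... | yes _ = x
    ... | no  _ = c u

    c′∈X : ∀ u → c′ u ∈ X u
    c′∈X u with u ≟ w
    ... | yes refl = x∈X
    ... | no _     = c∈X u

    below : ∀ {u} → u ≢ w → toℕ u < suc m → toℕ u < m
    below {u} u≢w u<1+m with m<1+n⇒m<n∨m≡n u<1+m
    ... | inj₁ u<m = u<m
    ... | inj₂ u≡m = contradiction (toℕ-injective (trans u≡m (sym (toℕ-fromℕ< m<n)))) u≢w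

    indep′ : IndependentBelow (suc m) (c′ , c′∈X)
    indep′ u v u<1+m v<1+m with u ≟ w | v ≟ w
    ... | yes _  | yes _  = loopless H x
    ... | yes _  | no v≢w = trans (μ-sym H x (c v)) (free v v≢w)
    ... | no u≢w | yes _  = free u u≢w
    ... | no u≢w | no v≢w = indep u v (below u≢w u<1+m) (below v≢w v<1+m)

  independentBelow : ∀ m → m ≤ order G → ∃ (IndependentBelow m)
  independentBelow zero    _   = initialChoice , λ _ _ ()
  independentBelow (suc m) m<n with choice , indep ← independentBelow m (ℕ.<⇒≤ m<n) =
    rechoose choice m<n indep

  edgelessTransversal : ∃ λ T → IsTransversal C T × (∀ i j → μ (H [ T ]) i j ≡ 0)
  edgelessTransversal with (c , c∈X) , indep ← independentBelow (order G) ℕ.≤-refl =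
    T , isTransversal , noEdges
    where
    T? : ∀ x → Dec (∃ λ v → c v ≡ x)
    T? x = any? λ v → c v ≟ x

    T : Subset (order H)
    T = comprehension T?

    isTransversal : IsTransversal C T
    isTransversal v = unique⇒∣∣≡1 (T ∩ X v)
      (x∈p∩q⁺ (∈-comprehension⁺ T? (v , refl) , c∈X v) , λ y∈ → unique (x∈p∩q⁻ T (X v) y∈))
      where
      unique : ∀ {y} → y ∈ T × y ∈ X v → y ≡ c v
      unique (y∈T , y∈X) with u , refl ← ∈-comprehension⁻ T? y∈T =
        cong c (∈-X-unique C (c∈X u) y∈X)

    noEdges : ∀ i j → μ (H [ T ]) i j ≡ 0
    noEdges i j
      with u , eq ← ∈-comprehension⁻ T? (elements-∈ T i)
         | v , eq′ ← ∈-comprehension⁻ T? (elements-∈ T j) =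
      trans (sym (cong₂ (μ H) eq eq′)) (indep u v (toℕ<n u) (toℕ<n v))

-- Least values and critical induced subgraphs

module _ {ℓ} (em : ExcludedMiddle ℓ) where

  -- `Q` comes with no decision procedure, so excluded middle tells whether a smaller witness
  -- exists; well-foundedness ends the descent.
  least : ∀ (Q : ℕ → Set ℓ) {k} → Acc _<_ k → Q k → ∃ λ m → Q m × (∀ j → Q j → m ≤ j)
  least Q {k} (acc rec) q with em {∃ λ j → j < k × Q j}
  ... | yes (j , j<k , q′) = least Q (rec j<k) q′
  ... | no ¬smaller = k , q , λ j q′ → ≮⇒≥ λ j<k → ¬smaller (j , j<k , q′)

  χDP-exists : (P : GraphProperty ℓ) → Reliable P → ∀ G → ∃ (χDP P G)
  χDP-exists P (nonTrivial , hereditary , additive) G with b , μ≤b ← μ-bounded G =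
    -- The descent starts at one more than the number of vertices that can be blocked in any `X v`.
    least (EveryKCoverHasPTransversal P G) (<-wellFounded (suc (order G * b))) λ C kCover →
      let T , transversal , μ≡0 = edgelessTransversal C μ≤b kCover
      in T , transversal , μ≡0⇒has P hereditary nonTrivial additive (Cover.H C [ T ]) μ≡0

  minimalInduced : (P : GraphProperty ℓ) (G : Graph) {k : ℕ} (S : Subset (order G)) →
    Acc _<_ ∣ S ∣ → χDP P (G [ S ]) k →
    ∃ λ R → χDP P (G [ R ]) k × (∀ Q → ∣ Q ∣ < ∣ R ∣ → ¬ χDP P (G [ Q ]) k)
  minimalInduced P G {k} S (acc rec) χS with em {∃ λ R → ∣ R ∣ < ∣ S ∣ × χDP P (G [ R ]) k}
  ... | yes (R , R<S , χR) = minimalInduced P G R (rec R<S) χR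
  ... | no ¬smaller = S , χS , λ Q Q<S χQ → ¬smaller (Q , Q<S , χQ)

  -- Let `i`, `j` and `k` be the values for the iterated subgraph, for the corresponding induced
  -- subgraph of `G`, and for `G`. Monotonicity gives i ≤ j ≤ k, and j = k would contradict the
  -- minimality of `S`, as the middle subgraph has fewer vertices.
  minimal⇒critical : (P : GraphProperty ℓ) → Reliable P → ∀ {G k} → χDP P G k →
    ∀ S → χDP P (G [ S ]) k → (∀ Q → ∣ Q ∣ < ∣ S ∣ → ¬ χDP P (G [ Q ]) k) →
    Critical P (G [ S ])
  minimal⇒critical P reliable@(_ , hereditary , _) {G} {k} χG S χS minimal R R⊂⊤ =
    compare (χDP-exists P reliable ((G [ S ]) [ R ]))
            (χDP-exists P reliable (G [ subsetOfSubset S R ]))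
    where
    smaller : ∣ subsetOfSubset S R ∣ < ∣ S ∣
    smaller = ℕ.<-≤-trans
      (subst (_< ∣ ⊤ {∣ S ∣} ∣) (∣subsetOfSubset∣ S R) (p⊂q⇒∣p∣<∣q∣ R⊂⊤))
      (≤-reflexive (∣⊤∣≡n ∣ S ∣))

    compare : ∃ (χDP P ((G [ S ]) [ R ])) → ∃ (χDP P (G [ subsetOfSubset S R ])) →
      ∃₂ λ i j → χDP P ((G [ S ]) [ R ]) i × χDP P (G [ S ]) j × i < j
    compare (i , χR) (j , χQ) = i , k , χR , χS , ℕ.≤-<-trans
      (χDP-mono-↪ P hereditary (induced-induced-↪ G S R) χR χQ)
      (≤∧≢⇒< (χDP-mono-↪ P hereditary (elements-↪ G (subsetOfSubset S R)) χQ χG)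
        λ { refl → minimal (subsetOfSubset S R) smaller χQ })

-- `G` and `G [ ⊤ ]` embed in each other, so the same numbers work for both. This lets the search
-- for a smallest subgraph start at `⊤`.
χDP-induced-⊤ : ∀ {ℓ} (P : GraphProperty ℓ) → Hereditary P → ∀ {G k} →
  χDP P G k → χDP P (G [ ⊤ ]) k
χDP-induced-⊤ P hereditary {G} (every , least) =
  everyKCover-↪ P hereditary (elements-↪ G ⊤) every ,
  λ j every′ → least j
    (everyKCover-↪ P hereditary (↪-restrict (id-↪ G) ⊤ (λ _ → ∈⊤)) every′)

proposition2 : ∀ {ℓ} → ExcludedMiddle ℓ →
    (P : GraphProperty ℓ) → Reliable P → (G : Graph) →
    ∃ λ (S : Subset (order G)) →
    (∃ λ k → χDP P (G [ S ]) k × χDP P G k) × Critical P (G [ S ])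
proposition2 em P reliable@(_ , hereditary , _) G =
  let k , χG = χDP-exists em P reliable G
      S , χS , minimal = minimalInduced em P G ⊤ (<-wellFounded ∣ ⊤ {order G} ∣)
                           (χDP-induced-⊤ P hereditary χG)
  in S , (k , χS , χG) , minimal⇒critical em P reliable χG S χS minimal
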